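{- Let $n \ge 1$ be an integer and $d \ge 0$. For each real $x \ge 0$ let $h_1(x),\dots,h_n(x)$ be jointly distributed, discrete random variables with $0 \le h_i(x) \le x$, and let $W(x)$ be a non-negative real random variable. Let $a:[0,\infty)\to[0,\infty)$ satisfy $a(x)=0$ for $x\le d$ and $a(x)>0$ for $x>d$, and suppose that for $x>d$ the probabilistic recurrence $$W(x) = a(x) + \sum_{i=1}^n W(h_i(x))$$ holds (as an identity of distributions, as explained in the context). Suppose that for every $x$ there is some $k$ such that the recurrence started from $x$ terminates after at most $k$ nested recursive calls, i.e. with probability one every chain of $k$ successive recursive calls started from $x$ reaches a size at most $d$. Let $m:[0,\infty)\to[0,\infty)$ satisfy $E\left[\max_{i=1}^n h_i(x)\right]\le m(x)$ and $0\le m(x)\le x$ for all $x$, with $m(x)/x$ non-decreasing on $(0,\infty)$. Let $g_1:\mathbb{R}\to[0,\infty)$ and $g_2:\mathbb{R}\to(0,\infty)$ be functions with $g_1(x)\ge 1$ for all $x>d$, such that for all $x>d$ and all $(y_1,\dots,y_n)$ in the support of the joint distribution of $(h_1(x),\dots,h_n(x))$, $$\sum_{i=1}^n g_1(y_i)\le g_1(x)\qquad\text{and}\qquad \sum_{i=1}^n g_2(y_i)\le g_2(x).$$ Let $u:[0,\infty)\to\mathbb{R}$ be a solution of the recurrence $$u(x)=\frac{a(x)}{g_2(x)}+u(m(x)),$$ such that $u(x)=u(d)$ for all $x\le d$ and $W(x)/g_2(x)\le u(x)$ almost surely for all $x\le d$. If $a/g_2$ and $u$ are continuous and $a/g_2$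 is strictly increasing on the set $\{x \mid a(x)/g_2(x)>0\}$, then for all positive integers $w$ and all $x>0$ such that $g_1(x)\ge 1$, $$\Pr\left[W(x)>g_2(x)u(x)+w\,a(x)\right]\le g_1(x)\left(\frac{m(x)}{x}\right)^w .$$
   Context: The probabilistic recurrence is a statement about distributions, not about random variables as functions on a sample space: for all $x>d$ and all $r\in\mathbb{R}$, $$\Pr[W(x)>r]=\sum_{y_1,\dots,y_n}\Pr\left[(h_1(x),\dots,h_n(x))=(y_1,\dots,y_n)\right]\cdot\Pr\left[\sum_{i=1}^n W(y_i)>r-a(x)\right].$$ Here, in the last factor, $W(y_1),\dots,W(y_n)$ are taken on some common probability space with the given marginal laws; no independence is required. The function $a$ is called the toll function, and $d$ is the size at which the recursion stops. The termination assumption says: for every $x$ there is $k$ such that whenever $x=x_0,x_1,\dots,x_k$ is a sequence in which each $x_{j+1}$ is a value taken with positive probability by some $h_i(x_j)$, we have $x_k\le d$. -}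

module Defs where

open import Algebra.Bundles using (CommutativeRing; Semiring)
open import Algebra.Structures using (IsCommutativeRing)
import Algebra.Construct.NaturalChoice.Max as Max
import Algebra.Definitions.RawSemiring as RawSemiringDefinitions
open import Data.Fin.Base using (Fin)
open import Data.List.Base as List using (List)
open import Data.List.Relation.Unary.Unique.Propositional using (Unique)
open import Data.Nat.Base as ℕ using (ℕ; suc; NonZero)
open import Data.Product.Base using (_×_; ∃; ∃-syntax)
open import Data.Vec.Base as Vec using (Vec; tabulate)
open import Data.Vec.Membership.Propositional using (_∈_)
open import Level using (0ℓ)
open import Relation.Binary.Bundles using (TotalOrder)
open import Relation.Binary.PropositionalEquality using (_≡_; _≢_)
open import Relation.Binary.Structures using (IsTotalOrder)
import Relation.Binary.Construct.NonStrictToStrict as NonStrictToStrict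
open import Relation.Unary using (Pred; U; ∁; _≐_; _⊥_; ⋃)

-- The real numbers are characterised, uniquely up to isomorphism, as a
-- Dedekind-complete totally ordered field.  The value of 0# ⁻¹ is
-- unconstrained.

record CompleteOrderedField : Set₁ where
  infix  8 _⁻¹
  infix  8 -_
  infixl 7 _*_ _/_
  infixl 6 _+_ _-_
  infix  4 _≤_
  field
    ℝ   : Set
    _+_ : ℝ → ℝ → ℝ
    _*_ : ℝ → ℝ → ℝ
    -_  : ℝ → ℝ
    _⁻¹ : ℝ → ℝ
    0#  : ℝ
    1#  : ℝ
    _≤_ : ℝ → ℝ → Set
    isCommutativeRing : IsCommutativeRing _≡_ _+_ _*_ -_ 0# 1#
    0≢1               : 0# ≢ 1#
    *-inverseʳ        : ∀ x → x ≢ 0# → x * x ⁻¹ ≡ 1#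
    isTotalOrder      : IsTotalOrder _≡_ _≤_
    +-monoˡ-≤         : ∀ {x y} z → x ≤ y → x + z ≤ y + z
    *-nonNeg          : ∀ {x y} → 0# ≤ x → 0# ≤ y → 0# ≤ x * y

  IsUpperBound : Pred ℝ 0ℓ → ℝ → Set
  IsUpperBound P b = ∀ x → P x → x ≤ b

  IsLub : Pred ℝ 0ℓ → ℝ → Set
  IsLub P s = IsUpperBound P s × (∀ b → IsUpperBound P b → s ≤ b)

  field
    complete : (P : Pred ℝ 0ℓ) → ∃ P → ∃ (IsUpperBound P) → ∃ (IsLub P)

  commutativeRing : CommutativeRing 0ℓ 0ℓ
  commutativeRing = record { isCommutativeRing = isCommutativeRing }

  totalOrder : TotalOrder 0ℓ 0ℓ 0ℓ
  totalOrder = record { isTotalOrder = isTotalOrder }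

  open NonStrictToStrict _≡_ _≤_ public using (_<_)
  open Max totalOrder public using (_⊔_)
  open RawSemiringDefinitions
    (Semiring.rawSemiring (CommutativeRing.semiring commutativeRing)) public
    using (_^_) renaming (_×_ to _·_)

  _-_ : ℝ → ℝ → ℝ
  x - y = x + - y

  _/_ : ℝ → ℝ → ℝ
  x / y = x * y ⁻¹

  ∣_∣ : ℝ → ℝ
  ∣ x ∣ = x ⊔ (- x)

  sum : ∀ {n} → Vec ℝ n → ℝ
  sum = Vec.foldr′ _+_ 0#

  maximum : ∀ {n} → .{{NonZero n}} → Vec ℝ n → ℝ
  maximum {suc n} = Vec.foldr₁ _⊔_

  -- Functions with domain [0,∞) are represented by functions ℝ → ℝ whose
  -- values at negative arguments are irrelevant.

  ContinuousOnNonNeg : (ℝ → ℝ) → Set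
  ContinuousOnNonNeg f =
    ∀ x → 0# ≤ x → ∀ ε → 0# < ε →
    ∃[ δ ] (0# < δ × (∀ y → 0# ≤ y → ∣ y - x ∣ < δ → ∣ f y - f x ∣ < ε))

module Probability (R : CompleteOrderedField) where
  open CompleteOrderedField R

  -- Unordered sum of a family of non-negative terms (with no restriction
  -- on the index type): the least upper bound of the finite partial sums.

  FinitePartialSum : {A : Set} → (A → ℝ) → Pred ℝ 0ℓ
  FinitePartialSum {A} f t =
    ∃[ xs ] (Unique xs × t ≡ List.foldr _+_ 0# (List.map f xs))

  IsSum : {A : Set} → (A → ℝ) → ℝ → Set
  IsSum f = IsLub (FinitePartialSum f)

  -- A discrete distribution is given by its mass function.  Since the
  -- masses sum to 1, only countably many of them are nonzero.

  record DiscreteDistribution (A : Set) : Set where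
    field
      mass        : A → ℝ
      mass-nonNeg : ∀ x → 0# ≤ mass x
      mass-total  : IsSum mass 1#

  open DiscreteDistribution public

  Support : {A : Set} → DiscreteDistribution A → Pred A 0ℓ
  Support μ x = 0# < mass μ x

  -- Meaningful for f non-negative on the support of μ.

  IsExpectation : {A : Set} → DiscreteDistribution A → (A → ℝ) → ℝ → Set
  IsExpectation μ f = IsSum (λ x → mass μ x * f x)

  -- Pr is unconstrained outside the σ-algebra of events.

  record ProbabilitySpace : Set₁ where
    field
      Ω       : Set
      IsEvent : Pred Ω 0ℓ → Set
      Pr      : Pred Ω 0ℓ → ℝ
      IsEvent-resp-≐ : ∀ {A B} → A ≐ B → IsEvent A → IsEvent B
      IsEvent-U      : IsEvent U
      IsEvent-∁      : ∀ {A} → IsEvent A → IsEvent (∁ A)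
      IsEvent-⋃      : (A : ℕ → Pred Ω 0ℓ) → (∀ i → IsEvent (A i)) →
                       IsEvent (⋃ ℕ A)
      Pr-cong        : ∀ {A B} → IsEvent A → A ≐ B → Pr A ≡ Pr B
      Pr-nonNeg      : ∀ {A} → IsEvent A → 0# ≤ Pr A
      Pr-U           : Pr U ≡ 1#
      Pr-⋃           : (A : ℕ → Pred Ω 0ℓ) → (∀ i → IsEvent (A i)) →
                       (∀ i j → i ≢ j → A i ⊥ A j) →
                       IsSum (λ i → Pr (A i)) (Pr (⋃ ℕ A))

  open ProbabilitySpace public using (Ω)

  record RandomVariable (S : ProbabilitySpace) : Set where
    open ProbabilitySpace S using (IsEvent)
    field
      value      : Ω S → ℝ
      measurable : ∀ r → IsEvent (λ ω → r < value ω)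

  open RandomVariable public

  Pr[_>_] : ∀ {S} → RandomVariable S → ℝ → ℝ
  Pr[_>_] {S} X r = ProbabilitySpace.Pr S (λ ω → r < value X ω)

  AlmostSurely : (S : ProbabilitySpace) → Pred (Ω S) 0ℓ → Set
  AlmostSurely S A = IsEvent A × Pr A ≡ 1#
    where open ProbabilitySpace S

  -- Random variables on one common space with prescribed marginal laws; a
  -- law on ℝ is determined by its tail function.

  record Coupling {n} {S : Fin n → ProbabilitySpace}
                  (X : ∀ i → RandomVariable (S i)) : Set₁ where
    field
      space    : ProbabilitySpace
      copy     : Fin n → RandomVariable space
      marginal : ∀ i r → Pr[ copy i > r ] ≡ Pr[ X i > r ]

  PrSum[_>_] : ∀ {n} {S : Fin n → ProbabilitySpace}
               {X : ∀ i → RandomVariable (S i)} → Coupling X → ℝ → ℝ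
  PrSum[ C > r ] = Pr (λ ω → r < sum (tabulate (λ i → value (copy i) ω)))
    where
    open Coupling C
    open ProbabilitySpace space using (Pr)

  -- y is a value taken with positive probability by some hᵢ(x), i.e. a
  -- coordinate of some tuple in the support of h x.

  Calls : ∀ {n} → (ℝ → DiscreteDistribution (Vec ℝ n)) → ℝ → ℝ → Set
  Calls h x y = ∃[ v ] (Support (h x) v × y ∈ v)

  TerminatesWithin : (ℝ → ℝ → Set) → ℝ → ℕ → ℝ → Set
  TerminatesWithin _⟶_ d k x =
    (s : ℕ → ℝ) → s 0 ≡ x → (∀ j → j ℕ.< k → s j ⟶ s (suc j)) → s k ≤ d

{-# OPTIONS --safe #-}
module Submission where

-- Write A = a / g₂ and ρ x = m x / x.  The induction on the depth of the
-- recursion goes through for the statement: for every j and every scale z > 0,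
--   u z + j A x ≤ r  implies  Pr[W x > g₂ x r] ≤ g₁ x ρ(x)ʲ x / z;
-- the theorem is the case z = x, j = w.  (The best choice z = u⁻¹(r - j A x)
-- would give Karp's bound, but quantifying over z avoids inverting u.)
--
-- For x > d put r′ = r - A x.  A union bound over the calls, with thresholds
-- g₂(yᵢ) r′, shows that a bound g₁ y C y on Pr[W y > g₂ y r′] for all the sizes
-- y called from x yields the bound g₁ x C E[maxᵢ hᵢ(x)] ≤ g₁ x C m(x) at x.
-- If j > 0, the induction hypothesis for (j - 1, z) gives C = ρ(x)ʲ⁻¹ / z.
-- If j = 0 and z ≤ x, the bound is at least 1.  If j = 0 and z > x, then
-- u (m z) = u z - A z ≤ r′, so the hypothesis for (0, m z) gives C = 1 / m z,
-- and m x / m z ≤ x / z because ρ is non-decreasing; if m z = 0, then m x = 0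
-- and x calls itself only on size 0, where the tail vanishes.

open import Defs
open import Algebra.Bundles using (CommutativeRing)
import Algebra.Construct.NaturalChoice.Max as Max
import Algebra.Properties.Ring
import Algebra.Properties.Semiring.Mult
import Algebra.Solver.Ring.NaturalCoefficients.Default as NaturalCoefficients
open import Axiom.ExcludedMiddle using (ExcludedMiddle)
open import Data.Empty using (⊥-elim)
open import Data.Fin.Base using (Fin; zero; suc)
open import Data.List.Base as List using (List; []; _∷_)
open import Data.List.Relation.Unary.All as ListAll using ([]; _∷_)
open import Data.List.Relation.Unary.AllPairs using ([]; _∷_)
open import Data.List.Relation.Unary.Unique.Propositional using (Unique)
open import Data.Nat.Base using (ℕ; zero; suc; s≤s; NonZero)
open import Data.Nat.GeneralisedArithmetic using (fold)
open import Data.Product.Base using (_×_; _,_; proj₁; proj₂; ∃-syntax; Σ-syntax)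
open import Data.Sum.Base using (_⊎_; inj₁; inj₂)
open import Data.Vec.Base using (Vec; []; _∷_; lookup; map; tabulate)
open import Data.Vec.Membership.Propositional.Properties using (∈-lookup)
open import Data.Vec.Properties using (tabulate-∘; tabulate∘lookup)
open import Data.Vec.Relation.Unary.All using (All)
open import Data.Vec.Relation.Unary.All.Properties using (lookup⁺)
open import Function.Base using (_∘_; const)
open import Level using (0ℓ)
open import Relation.Binary.Bundles using (TotalOrder)
open import Relation.Binary.PropositionalEquality
  using (_≡_; _≢_; refl; sym; trans; cong; cong₂; subst; subst₂)
import Relation.Binary.Reasoning.PartialOrder as PartialOrderReasoning
open import Relation.Nullary using (¬_; yes; no; contradiction)
open import Relation.Nullary.Decidable using (decidable-stable)
open import Relation.Unary using (Pred; ∅; ∁; _∪_; _∩_; _⊆_; _≐_; _⊥_; ⋃)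

-- Arithmetic, density of the rationals and finite sums in a complete ordered field.

module OrderedField (lem : ExcludedMiddle 0ℓ) (R : CompleteOrderedField) where
  open CompleteOrderedField R
  open CommutativeRing commutativeRing public using
    ( +-comm; +-identityˡ; +-identityʳ; *-comm; *-identityˡ; *-identityʳ
    ; zeroˡ; zeroʳ; distribˡ; distribʳ; -‿inverseʳ; -‿inverseˡ)
  open CommutativeRing commutativeRing using (ring; semiring; commutativeSemiring)
  open Algebra.Properties.Ring ring public using (-1*x≈-x; -‿involutive; -0#≈0#)
    renaming (⁻¹-anti-homo‿- to -[x-y]≡y-x; //-rightDividesˡ to x-y+y≡x; //-rightDividesʳ to x+y-y≡x)
  open Algebra.Properties.Semiring.Mult semiring public using (×-comm-*; ×-assoc-*)
  open NaturalCoefficients commutativeSemiring public using (solve; _:+_; _:*_; _:=_)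
  open TotalOrder totalOrder public using (poset; total; antisym)
    renaming (refl to ≤-refl; trans to ≤-trans; reflexive to ≤-reflexive)
  open Max totalOrder public using (⊔-sel; x≤x⊔y; x≤y⊔x)
  open PartialOrderReasoning poset

  ≰⇒> : ∀ {x y} → ¬ x ≤ y → y < x
  ≰⇒> {x} {y} x≰y with total x y
  ... | inj₁ x≤y = contradiction x≤y x≰y
  ... | inj₂ y≤x = y≤x , λ y≡x → x≰y (≤-reflexive (sym y≡x))

  <⇒≱ : ∀ {x y} → x < y → ¬ y ≤ x
  <⇒≱ (x≤y , x≢y) y≤x = x≢y (antisym x≤y y≤x)

  ≤-<-connex : ∀ x y → x ≤ y ⊎ y < x
  ≤-<-connex x y with lem {x ≤ y}
  ... | yes x≤y = inj₁ x≤y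
  ... | no  x≰y = inj₂ (≰⇒> x≰y)

  +-monoʳ-≤ : ∀ {x y} z → x ≤ y → z + x ≤ z + y
  +-monoʳ-≤ z = subst₂ _≤_ (+-comm _ z) (+-comm _ z) ∘ +-monoˡ-≤ z

  +-mono-≤ : ∀ {x y z w} → x ≤ y → z ≤ w → x + z ≤ y + w
  +-mono-≤ x≤y z≤w = ≤-trans (+-monoˡ-≤ _ x≤y) (+-monoʳ-≤ _ z≤w)

  +-cancelʳ-≤ : ∀ {x y} z → x + z ≤ y + z → x ≤ y
  +-cancelʳ-≤ z = subst₂ _≤_ (x+y-y≡x z _) (x+y-y≡x z _) ∘ +-monoˡ-≤ (- z)

  +-monoˡ-< : ∀ {x y} z → x < y → x + z < y + z
  +-monoˡ-< z x<y = ≰⇒> (<⇒≱ x<y ∘ +-cancelʳ-≤ z)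

  x≤x+y : ∀ {x y} → 0# ≤ y → x ≤ x + y
  x≤x+y {x} {y} 0≤y = subst (_≤ x + y) (+-identityʳ x) (+-monoʳ-≤ x 0≤y)

  x≤y+x : ∀ {x y} → 0# ≤ y → x ≤ y + x
  x≤y+x {x} {y} 0≤y = subst (_≤ y + x) (+-identityˡ x) (+-monoˡ-≤ x 0≤y)

  +≤⇒≤- : ∀ {x y z} → x + y ≤ z → x ≤ z - y
  +≤⇒≤- {x} {y} {z} = +-cancelʳ-≤ y ∘ subst (x + y ≤_) (sym (x-y+y≡x y z))

  ≤-⇒+≤ : ∀ {x y z} → x ≤ z - y → x + y ≤ z
  ≤-⇒+≤ {x} {y} {z} = subst (x + y ≤_) (x-y+y≡x y z) ∘ +-monoˡ-≤ y

  ≤⇒0≤- : ∀ {x y} → x ≤ y → 0# ≤ y - x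
  ≤⇒0≤- {x} = +≤⇒≤- ∘ subst (_≤ _) (sym (+-identityˡ x))

  <⇒0<- : ∀ {x y} → x < y → 0# < y - x
  <⇒0<- {x} {y} x<y = subst (_< _) (-‿inverseʳ x) (+-monoˡ-< (- x) x<y)

  neg-mono-≤ : ∀ {x y} → x ≤ y → - y ≤ - x
  neg-mono-≤ {x} {y} x≤y = +-cancelʳ-≤ y
    (subst₂ _≤_ (sym (-‿inverseˡ y)) (+-comm y (- x)) (≤⇒0≤- x≤y))

  neg-cancel-< : ∀ {x y} → - x < - y → y < x
  neg-cancel-< -x<-y = ≰⇒> (<⇒≱ -x<-y ∘ neg-mono-≤)

  *-monoˡ-≤ : ∀ {x y z} → 0# ≤ z → x ≤ y → x * z ≤ y * z
  *-monoˡ-≤ {x} {y} {z} 0≤z x≤y = begin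
    x * z                  ≤⟨ x≤y+x (*-nonNeg (≤⇒0≤- x≤y) 0≤z) ⟩
    (y - x) * z + x * z    ≡⟨ distribʳ z (y - x) x ⟨
    (y - x + x) * z        ≡⟨ cong (_* z) (x-y+y≡x x y) ⟩
    y * z                  ∎

  *-monoʳ-≤ : ∀ {x y z} → 0# ≤ z → x ≤ y → z * x ≤ z * y
  *-monoʳ-≤ 0≤z = subst₂ _≤_ (*-comm _ _) (*-comm _ _) ∘ *-monoˡ-≤ 0≤z

  0≤1 : 0# ≤ 1#
  0≤1 with total 0# 1#
  ... | inj₁ 0≤1 = 0≤1
  ... | inj₂ 1≤0 = subst (0# ≤_) (trans (-1*x≈-x (- 1#)) (-‿involutive 1#)) (*-nonNeg 0≤-1 0≤-1)
    where
    0≤-1 : 0# ≤ - 1#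
    0≤-1 = subst (0# ≤_) (+-identityˡ (- 1#)) (≤⇒0≤- 1≤0)

  0<1 : 0# < 1#
  0<1 = 0≤1 , 0≢1

  x*x⁻¹≡1 : ∀ {x} → 0# < x → x * x ⁻¹ ≡ 1#
  x*x⁻¹≡1 {x} 0<x = *-inverseʳ x (proj₂ 0<x ∘ sym)

  ⁻¹-pos : ∀ {x} → 0# < x → 0# < x ⁻¹
  ⁻¹-pos {x} 0<x = ≰⇒> λ x⁻¹≤0 → <⇒≱ 0<1
    (subst₂ _≤_ (x*x⁻¹≡1 0<x) (zeroʳ x) (*-monoʳ-≤ (proj₁ 0<x) x⁻¹≤0))

  *-cancelˡ-≤ : ∀ {x y z} → 0# < z → z * x ≤ z * y → x ≤ y
  *-cancelˡ-≤ {x} {y} {z} 0<z zx≤zy = subst₂ _≤_ (cancel x) (cancel y)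
    (*-monoʳ-≤ (proj₁ (⁻¹-pos 0<z)) zx≤zy)
    where
    cancel : ∀ t → z ⁻¹ * (z * t) ≡ t
    cancel t = begin-equality
      z ⁻¹ * (z * t)    ≡⟨ solve 3 (λ i z t → i :* (z :* t) := z :* i :* t) refl (z ⁻¹) z t ⟩
      z * z ⁻¹ * t      ≡⟨ cong (_* t) (x*x⁻¹≡1 0<z) ⟩
      1# * t            ≡⟨ *-identityˡ t ⟩
      t                 ∎

  *-cancelˡ-< : ∀ {x y z} → 0# ≤ z → z * x < z * y → x < y
  *-cancelˡ-< 0≤z zx<zy = ≰⇒> (<⇒≱ zx<zy ∘ *-monoʳ-≤ 0≤z)

  *-pos : ∀ {x y} → 0# < x → 0# < y → 0# < x * y
  *-pos {x} 0<x 0<y = ≰⇒> λ xy≤0 →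
    <⇒≱ 0<y (*-cancelˡ-≤ 0<x (subst (_ ≤_) (sym (zeroʳ x)) xy≤0))

  x*[y/x]≡y : ∀ {x} y → 0# < x → x * (y / x) ≡ y
  x*[y/x]≡y {x} y 0<x = begin-equality
    x * (y * x ⁻¹)    ≡⟨ solve 3 (λ x y i → x :* (y :* i) := x :* i :* y) refl x y (x ⁻¹) ⟩
    x * x ⁻¹ * y      ≡⟨ cong (_* y) (x*x⁻¹≡1 0<x) ⟩
    1# * y            ≡⟨ *-identityˡ y ⟩
    y                 ∎

  /-nonNeg : ∀ {x y} → 0# ≤ x → 0# < y → 0# ≤ x / y
  /-nonNeg 0≤x 0<y = *-nonNeg 0≤x (proj₁ (⁻¹-pos 0<y))

  /≤⇒≤* : ∀ {x y z} → 0# < z → x / z ≤ y → x ≤ z * y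
  /≤⇒≤* 0<z x/z≤y = subst (_≤ _) (x*[y/x]≡y _ 0<z) (*-monoʳ-≤ (proj₁ 0<z) x/z≤y)

  *≤⇒≤/ : ∀ {x y z} → 0# < z → z * x ≤ y → x ≤ y / z
  *≤⇒≤/ 0<z zx≤y = *-cancelˡ-≤ 0<z (subst (_ ≤_) (sym (x*[y/x]≡y _ 0<z)) zx≤y)

  <⇒/<1 : ∀ {x y} → 0# < y → x < y → x / y < 1#
  <⇒/<1 {x} {y} 0<y x<y = *-cancelˡ-< (proj₁ 0<y)
    (subst₂ _<_ (sym (x*[y/x]≡y x 0<y)) (sym (*-identityʳ y)) x<y)

  ^-nonNeg : ∀ {x} k → 0# ≤ x → 0# ≤ x ^ k
  ^-nonNeg zero    0≤x = 0≤1
  ^-nonNeg (suc k) 0≤x = *-nonNeg 0≤x (^-nonNeg k 0≤x)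

  ^-mono-≤ : ∀ {x y} k → 0# ≤ x → x ≤ y → x ^ k ≤ y ^ k
  ^-mono-≤ zero    0≤x x≤y = ≤-refl
  ^-mono-≤ (suc k) 0≤x x≤y = ≤-trans
    (*-monoˡ-≤ (^-nonNeg k 0≤x) x≤y) (*-monoʳ-≤ (≤-trans 0≤x x≤y) (^-mono-≤ k 0≤x x≤y))

  ·-nonNeg : ∀ {x} k → 0# ≤ x → 0# ≤ k · x
  ·-nonNeg zero    0≤x = ≤-refl
  ·-nonNeg (suc k) 0≤x = ≤-trans 0≤x (x≤x+y (·-nonNeg k 0≤x))

  ·-mono-≤ : ∀ {x y} k → x ≤ y → k · x ≤ k · y
  ·-mono-≤ zero    x≤y = ≤-refl
  ·-mono-≤ (suc k) x≤y = +-mono-≤ x≤y (·-mono-≤ k x≤y)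

  -- If the values were bounded, let `s` be their supremum. Each `f k + c` lies below `f (suc k)`,
  -- hence below `s`, so `s - c` would be a smaller upper bound. This serves both the Archimedean
  -- property and the decay of the iterates of `m`.
  linear-growth-unbounded : (f : ℕ → ℝ) → ∀ {c} → 0# < c → (∀ k → f k + c ≤ f (suc k)) →
                            ∀ b → ∃[ k ] b < f k
  linear-growth-unbounded f {c} 0<c grows b with lem {∃[ k ] b < f k}
  ... | yes exceeds = exceeds
  ... | no  bounded = contradiction s≤s-c (<⇒≱ s-c<s)
    where
    range : ℝ → Set
    range t = ∃[ k ] t ≡ f k

    f≤b : IsUpperBound range b
    f≤b _ (k , refl) with ≤-<-connex (f k) b
    ... | inj₁ fk≤b = fk≤b
    ... | inj₂ b<fk = contradiction (k , b<fk) bounded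

    lub : ∃[ s ] IsLub range s
    lub = complete range (f 0 , 0 , refl) (b , f≤b)

    s : ℝ
    s = proj₁ lub

    s≤s-c : s ≤ s - c
    s≤s-c = proj₂ (proj₂ lub) (s - c) λ { _ (k , refl) →
      +≤⇒≤- (≤-trans (grows k) (proj₁ (proj₂ lub) _ (suc k , refl))) }

    s-c<s : s - c < s
    s-c<s = ≰⇒> λ s≤s-c → <⇒≱ (+-monoˡ-< s 0<c)
      (subst₂ _≤_ (+-comm s c) (sym (+-identityˡ s)) (≤-⇒+≤ s≤s-c))

  archimedean : ∀ {ε} → 0# < ε → ∀ x → ∃[ k ] x < k · ε
  archimedean {ε} 0<ε = linear-growth-unbounded (_· ε) 0<ε λ k → ≤-reflexive (+-comm (k · ε) ε)

  -- The search runs downwards from an Archimedean bound and stops at the first multiple of `ε`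
  -- whose predecessor no longer exceeds `x`.
  ceiling : ∀ {ε x} → 0# < ε → 0# ≤ x → ∃[ i ] (x < i · ε × i · ε ≤ x + ε)
  ceiling {ε} {x} 0<ε 0≤x = let (N , x<Nε) = archimedean 0<ε x in search N x<Nε
    where
    search : ∀ N → x < N · ε → ∃[ i ] (x < i · ε × i · ε ≤ x + ε)
    search zero    x<0  = contradiction 0≤x (<⇒≱ x<0)
    search (suc N) x<Nε with ≤-<-connex (N · ε) x
    ... | inj₁ Nε≤x  = suc N , x<Nε , subst (_≤ x + ε) (+-comm (N · ε) ε) (+-monoˡ-≤ ε Nε≤x)
    ... | inj₂ x<Nε′ = search N x<Nε′

  -- The fraction (i - j) / (k + 1). Indexing by three naturals turns a union over all rationals
  -- into three nested countable unions.
  rational : ℕ → ℕ → ℕ → ℝ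
  rational i j k = i · ((suc k · 1#) ⁻¹) - j · ((suc k · 1#) ⁻¹)

  -- Take `N` with 1 / N < t - s and shift `s` by a multiple of 1 / N to make it non-negative. The
  -- first multiple beyond the shifted `s` overshoots by at most 1 / N; shifting back lands strictly
  -- between `s` and `t`.
  rational-dense : ∀ {s t} → s < t → ∃[ i ] ∃[ j ] ∃[ k ] (s < rational i j k × rational i j k < t)
  rational-dense {s} {t} s<t with archimedean (<⇒0<- s<t) 1#
  ... | zero  , 1<0 = contradiction 0≤1 (<⇒≱ 1<0)
  ... | suc k , 1<N[t-s] = i , j , k , s<q , q<t
    where
    N ε : ℝ
    N = suc k · 1#
    ε = N ⁻¹

    0<N : 0# < N
    0<N = ≰⇒> λ N≤0 → <⇒≱ 0<1 (≤-trans (x≤x+y (·-nonNeg k 0≤1)) N≤0)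

    ε<t-s : ε < t - s
    ε<t-s = *-cancelˡ-< (proj₁ 0<N) (subst₂ _<_ (sym (x*x⁻¹≡1 0<N))
      (trans (cong (suc k ·_) (sym (*-identityˡ (t - s)))) (sym (×-assoc-* (suc k) 1# (t - s))))
      1<N[t-s])

    shift : ∃[ j ] - s < j · ε
    shift = archimedean (⁻¹-pos 0<N) (- s)

    j : ℕ
    j = proj₁ shift

    0≤s+jε : 0# ≤ s + j · ε
    0≤s+jε = subst (_≤ s + j · ε) (-‿inverseʳ s) (+-monoʳ-≤ s (proj₁ (proj₂ shift)))

    found : ∃[ i ] (s + j · ε < i · ε × i · ε ≤ s + j · ε + ε)
    found = ceiling (⁻¹-pos 0<N) 0≤s+jε

    i : ℕ
    i = proj₁ found

    s<q : s < rational i j k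
    s<q = ≰⇒> λ q≤s → <⇒≱ (proj₁ (proj₂ found))
      (subst (_≤ s + j · ε) (x-y+y≡x (j · ε) (i · ε)) (+-monoˡ-≤ (j · ε) q≤s))

    q<t : rational i j k < t
    q<t = begin-strict
      i · ε - j · ε                  ≤⟨ +-monoˡ-≤ (- (j · ε)) (proj₂ (proj₂ found)) ⟩
      s + j · ε + ε - j · ε
        ≡⟨ cong (_- j · ε) (solve 3 (λ s p e → s :+ p :+ e := e :+ s :+ p) refl s (j · ε) ε) ⟩
      ε + s + j · ε - j · ε          ≡⟨ x+y-y≡x (j · ε) (ε + s) ⟩
      ε + s                          <⟨ +-monoˡ-< s ε<t-s ⟩
      t - s + s                      ≡⟨ x-y+y≡x s t ⟩
      t                              ∎

  lookup≤maximum : ∀ {n} .{{_ : NonZero n}} (v : Vec ℝ n) i → lookup v i ≤ maximum v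
  lookup≤maximum (x ∷ [])     zero    = ≤-refl
  lookup≤maximum (x ∷ y ∷ ys) zero    = x≤x⊔y x (maximum (y ∷ ys))
  lookup≤maximum (x ∷ y ∷ ys) (suc i) =
    ≤-trans (lookup≤maximum (y ∷ ys) i) (x≤y⊔x x (maximum (y ∷ ys)))

  maximum-nonNeg : ∀ {n} .{{_ : NonZero n}} (v : Vec ℝ n) →
                   (∀ i → 0# ≤ lookup v i) → 0# ≤ maximum v
  maximum-nonNeg {suc n} v 0≤v = ≤-trans (0≤v zero) (lookup≤maximum v zero)

  sum-mono-≤ : ∀ {n} {f g : Fin n → ℝ} → (∀ i → f i ≤ g i) →
               sum (tabulate f) ≤ sum (tabulate g)
  sum-mono-≤ {zero}  f≤g = ≤-refl
  sum-mono-≤ {suc n} f≤g = +-mono-≤ (f≤g zero) (sum-mono-≤ (f≤g ∘ suc))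

  sum-*ʳ : ∀ {n} (f : Fin n → ℝ) c → sum (tabulate λ i → f i * c) ≡ sum (tabulate f) * c
  sum-*ʳ {zero}  f c = sym (zeroˡ c)
  sum-*ʳ {suc n} f c = trans (cong (f zero * c +_) (sum-*ʳ (f ∘ suc) c))
    (sym (distribʳ c (f zero) (sum (tabulate (f ∘ suc)))))

  sum-tabulate-lookup : ∀ {n} (g : ℝ → ℝ) (v : Vec ℝ n) →
                        sum (tabulate λ i → g (lookup v i)) ≡ sum (map g v)
  sum-tabulate-lookup g v =
    cong sum (trans (tabulate-∘ g (lookup v)) (cong (map g) (tabulate∘lookup v)))

  ∣x-0∣<y : ∀ {x y} → 0# ≤ x → x < y → ∣ x - 0# ∣ < y
  ∣x-0∣<y {x} {y} 0≤x x<y with ⊔-sel (x - 0#) (- (x - 0#))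
  ... | inj₁ eq = subst (_< y) (sym (trans eq x-0≡x)) x<y
    where
    x-0≡x : x - 0# ≡ x
    x-0≡x = trans (sym (+-identityʳ (x - 0#))) (x-y+y≡x 0# x)
  ... | inj₂ eq = begin-strict
    ∣ x - 0# ∣      ≡⟨ eq ⟩
    - (x - 0#)      ≡⟨ -[x-y]≡y-x x 0# ⟩
    0# - x          ≤⟨ +-monoˡ-≤ (- x) 0≤x ⟩
    x - x           ≡⟨ -‿inverseʳ x ⟩
    0#              ≤⟨ 0≤x ⟩
    x               <⟨ x<y ⟩
    y               ∎

  ∣y-x∣<x-z⇒z<y : ∀ {x y z} → ∣ y - x ∣ < x - z → z < y
  ∣y-x∣<x-z⇒z<y {x} {y} {z} close = ≰⇒> λ y≤z → <⇒≱ close (begin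
    x - z          ≤⟨ +-monoʳ-≤ x (neg-mono-≤ y≤z) ⟩
    x - y          ≡⟨ -[x-y]≡y-x y x ⟨
    - (y - x)      ≤⟨ x≤y⊔x (y - x) (- (y - x)) ⟩
    ∣ y - x ∣      ∎)

-- Unordered sums.

module Sums (lem : ExcludedMiddle 0ℓ) (R : CompleteOrderedField) where
  open CompleteOrderedField R
  open OrderedField lem R
  open Probability R
  open PartialOrderReasoning poset

  -- Comparing partial sums over the same finite list shows that `c * t` bounds all partial sums of
  -- `f`, and `s` is the least such bound.
  IsSum-mono : ∀ {A : Set} {f g : A → ℝ} {s t c} → 0# ≤ c → IsSum f s → IsSum g t →
               (∀ x → f x ≤ c * g x) → s ≤ c * t
  IsSum-mono {A} {f} {g} {s} {t} {c} 0≤c (_ , s-least) (t-bound , _) f≤cg =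
    s-least _ λ { _ (xs , unique , refl) →
      ≤-trans (partial xs) (*-monoʳ-≤ 0≤c (t-bound _ (xs , unique , refl))) }
    where
    partial : ∀ xs → List.foldr _+_ 0# (List.map f xs) ≤ c * List.foldr _+_ 0# (List.map g xs)
    partial []       = ≤-reflexive (sym (zeroʳ c))
    partial (x ∷ xs) = ≤-trans (+-mono-≤ (f≤cg x) (partial xs)) (≤-reflexive (sym (distribˡ c _ _)))

  -- A list without repetitions meets `i` at most once, and every other term is zero.
  sum-single : ∀ {I : Set} (f : I → ℝ) i → 0# ≤ f i → (∀ j → j ≢ i → f j ≡ 0#) →
               ∀ {js} → Unique js → List.foldr _+_ 0# (List.map f js) ≤ f i
  sum-single f i 0≤fi f≡0 []                     = 0≤fi
  sum-single f i 0≤fi f≡0 {j ∷ js} (j∉js ∷ unique) with lem {j ≡ i}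
  ... | yes refl = ≤-reflexive (trans (cong (f i +_) (sum-rest j∉js)) (+-identityʳ (f i)))
    where
    sum-rest : ∀ {js} → ListAll.All (i ≢_) js → List.foldr _+_ 0# (List.map f js) ≡ 0#
    sum-rest []            = refl
    sum-rest (i≢j ∷ i∉js) = trans (cong₂ _+_ (f≡0 _ (i≢j ∘ sym)) (sum-rest i∉js)) (+-identityʳ 0#)
  ... | no  j≢i = subst (_≤ f i)
    (sym (trans (cong (_+ rest) (f≡0 j j≢i)) (+-identityˡ rest)))
    (sum-single f i 0≤fi f≡0 unique)
    where
    rest : ℝ
    rest = List.foldr _+_ 0# (List.map f js)

-- Events, the union bound and measurability of finite sums.

module Events (lem : ExcludedMiddle 0ℓ) (R : CompleteOrderedField)
              (S : Probability.ProbabilitySpace R) where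
  open CompleteOrderedField R
  open OrderedField lem R
  open Sums lem R
  open Probability R hiding (Ω)
  open ProbabilitySpace S
  open PartialOrderReasoning poset

  private
    variable
      A B : Pred Ω 0ℓ

  prepend : Pred Ω 0ℓ → (ℕ → Pred Ω 0ℓ) → ℕ → Pred Ω 0ℓ
  prepend A B zero    = A
  prepend A B (suc i) = B i

  IsEvent-prepend : ∀ {B} → IsEvent A → (∀ i → IsEvent (B i)) → ∀ i → IsEvent (prepend A B i)
  IsEvent-prepend eA eB zero    = eA
  IsEvent-prepend eA eB (suc i) = eB i

  IsEvent-∅ : IsEvent ∅
  IsEvent-∅ = IsEvent-resp-≐ ((λ ¬⊤ → ¬⊤ _) , λ ()) (IsEvent-∁ IsEvent-U)

  -- Events are closed under countable unions by assumption, so the pair becomes the sequence `A`,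
  -- `B`, `B`, and so on.
  IsEvent-∪ : IsEvent A → IsEvent B → IsEvent (A ∪ B)
  IsEvent-∪ {A} {B} eA eB = IsEvent-resp-≐
    ( (λ { (zero , ωA) → inj₁ ωA ; (suc _ , ωB) → inj₂ ωB })
    , (λ { (inj₁ ωA) → 0 , ωA ; (inj₂ ωB) → 1 , ωB }))
    (IsEvent-⋃ (prepend A (const B)) (IsEvent-prepend eA (const eB)))

  -- De Morgan, with excluded middle removing the double negations.
  IsEvent-∩ : IsEvent A → IsEvent B → IsEvent (A ∩ B)
  IsEvent-∩ eA eB = IsEvent-resp-≐
    ( (λ ω∉ → stable (ω∉ ∘ inj₁) , stable (ω∉ ∘ inj₂))
    , (λ { (ωA , ωB) (inj₁ ω∉A) → ω∉A ωA ; (ωA , ωB) (inj₂ ω∉B) → ω∉B ωB }))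
    (IsEvent-∁ (IsEvent-∪ (IsEvent-∁ eA) (IsEvent-∁ eB)))
    where
    stable : ∀ {P : Set} → ¬ ¬ P → P
    stable = decidable-stable lem

  module _ (eA : IsEvent A) (eB : IsEvent B) (A⊥B : A ⊥ B) where
    private
      -- Padding with `∅` keeps the sequence pairwise disjoint, as countable additivity requires.
      seq : ℕ → Pred Ω 0ℓ
      seq = prepend A (prepend B (const ∅))

      seq-event : ∀ i → IsEvent (seq i)
      seq-event = IsEvent-prepend eA (IsEvent-prepend eB (const IsEvent-∅))

      seq-disjoint : ∀ i j → i ≢ j → seq i ⊥ seq j
      seq-disjoint 0             0             i≢j _         = i≢j refl
      seq-disjoint 0             1             i≢j           = A⊥B
      seq-disjoint 1             0             i≢j (ωB , ωA) = A⊥B (ωA , ωB)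
      seq-disjoint 1             1             i≢j _         = i≢j refl
      seq-disjoint 0             (suc (suc _)) i≢j (_ , ())
      seq-disjoint 1             (suc (suc _)) i≢j (_ , ())
      seq-disjoint (suc (suc _)) _             i≢j (() , _)

      ⋃seq≐A∪B : ⋃ ℕ seq ≐ A ∪ B
      ⋃seq≐A∪B = (λ { (0 , ωA) → inj₁ ωA ; (1 , ωB) → inj₂ ωB ; (suc (suc _) , ()) })
                , (λ { (inj₁ ωA) → 0 , ωA ; (inj₂ ωB) → 1 , ωB })

      Pr-seq : IsSum (Pr ∘ seq) (Pr (A ∪ B))
      Pr-seq = subst (IsSum (Pr ∘ seq))
        (Pr-cong (IsEvent-⋃ seq seq-event) ⋃seq≐A∪B) (Pr-⋃ seq seq-event seq-disjoint)

    -- The indices 0 and 1 alone already form a finite partial sum of the series for the union.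
    Pr-⊎-≥ : Pr A + Pr B ≤ Pr (A ∪ B)
    Pr-⊎-≥ = subst (_≤ _) (cong (Pr A +_) (+-identityʳ (Pr B)))
      (proj₁ Pr-seq _ (0 ∷ 1 ∷ [] , ((λ ()) ∷ []) ∷ [] ∷ [] , refl))

    -- With `Pr ∅` zero, the series splits into one supported at index 0 and one supported at index
    -- 1. The value of `Pr ∅` is taken as an argument because `Pr-∅` below is itself derived from
    -- `Pr-⊎-≥`.
    Pr-⊎-≤ : Pr ∅ ≡ 0# → Pr (A ∪ B) ≤ Pr A + Pr B
    Pr-⊎-≤ Pr-∅ = proj₂ Pr-seq _ λ { _ (is , unique , refl) → begin
      List.foldr _+_ 0# (List.map (Pr ∘ seq) is)
        ≡⟨ split is ⟩
      List.foldr _+_ 0# (List.map inA is) + List.foldr _+_ 0# (List.map inB is)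
        ≤⟨ +-mono-≤ (sum-single inA 0 (Pr-nonNeg eA) inA≡0 unique)
                    (sum-single inB 1 (Pr-nonNeg eB) inB≡0 unique) ⟩
      Pr A + Pr B  ∎ }
      where
      inA inB : ℕ → ℝ
      inA 0       = Pr A
      inA (suc _) = 0#
      inB 1       = Pr B
      inB _       = 0#

      inA≡0 : ∀ i → i ≢ 0 → inA i ≡ 0#
      inA≡0 0       0≢0 = contradiction refl 0≢0
      inA≡0 (suc _) _   = refl

      inB≡0 : ∀ i → i ≢ 1 → inB i ≡ 0#
      inB≡0 0             _   = refl
      inB≡0 1             1≢1 = contradiction refl 1≢1
      inB≡0 (suc (suc _)) _   = refl

      seq≡inA+inB : ∀ i → Pr (seq i) ≡ inA i + inB i
      seq≡inA+inB 0             = sym (+-identityʳ (Pr A))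
      seq≡inA+inB 1             = sym (+-identityˡ (Pr B))
      seq≡inA+inB (suc (suc _)) = trans Pr-∅ (sym (+-identityʳ 0#))

      split : ∀ is → List.foldr _+_ 0# (List.map (Pr ∘ seq) is) ≡
              List.foldr _+_ 0# (List.map inA is) + List.foldr _+_ 0# (List.map inB is)
      split []       = sym (+-identityʳ 0#)
      split (i ∷ is) = trans (cong₂ _+_ (seq≡inA+inB i) (split is))
        (solve 4 (λ a b c d → a :+ b :+ (c :+ d) := a :+ c :+ (b :+ d)) refl (inA i) (inB i) _ _)

  -- Superadditivity applied to two copies of `∅` gives 2 Pr(∅) ≤ Pr(∅).
  Pr-∅ : Pr ∅ ≡ 0#
  Pr-∅ = antisym Pr-∅≤0 (Pr-nonNeg IsEvent-∅)
    where
    Pr-∅≤0 : Pr ∅ ≤ 0#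
    Pr-∅≤0 = +-cancelʳ-≤ (Pr ∅) (begin
      Pr ∅ + Pr ∅    ≤⟨ Pr-⊎-≥ IsEvent-∅ IsEvent-∅ (λ ()) ⟩
      Pr (∅ ∪ ∅)
        ≡⟨ Pr-cong (IsEvent-∪ IsEvent-∅ IsEvent-∅) ((λ { (inj₁ ()) ; (inj₂ ()) }) , λ ()) ⟩
      Pr ∅           ≡⟨ +-identityˡ (Pr ∅) ⟨
      0# + Pr ∅      ∎)

  ∪-∖ : ∀ (A B : Pred Ω 0ℓ) → A ∪ (B ∩ ∁ A) ≐ A ∪ B
  ∪-∖ A B = (λ { (inj₁ ωA) → inj₁ ωA ; (inj₂ (ωB , _)) → inj₂ ωB })
          , (λ { (inj₁ ωA) → inj₁ ωA ; (inj₂ ωB) → add ωB })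
    where
    add : ∀ {ω} → B ω → (A ∪ (B ∩ ∁ A)) ω
    add {ω} ωB with lem {A ω}
    ... | yes ωA = inj₁ ωA
    ... | no  ω∉A = inj₂ (ωB , ω∉A)

  Pr-mono : IsEvent A → IsEvent B → A ⊆ B → Pr A ≤ Pr B
  Pr-mono {A} {B} eA eB A⊆B = begin
    Pr A                     ≤⟨ x≤x+y (Pr-nonNeg eB∖A) ⟩
    Pr A + Pr (B ∩ ∁ A)      ≤⟨ Pr-⊎-≥ eA eB∖A (λ { (ωA , _ , ω∉A) → ω∉A ωA }) ⟩
    Pr (A ∪ (B ∩ ∁ A))       ≡⟨ Pr-cong (IsEvent-∪ eA eB∖A) (∪-∖ A B) ⟩
    Pr (A ∪ B)
      ≡⟨ Pr-cong (IsEvent-∪ eA eB) ((λ { (inj₁ ωA) → A⊆B ωA ; (inj₂ ωB) → ωB }) , inj₂) ⟩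
    Pr B                     ∎
    where
    eB∖A : IsEvent (B ∩ ∁ A)
    eB∖A = IsEvent-∩ eB (IsEvent-∁ eA)

  Pr-∪-≤ : IsEvent A → IsEvent B → Pr (A ∪ B) ≤ Pr A + Pr B
  Pr-∪-≤ {A} {B} eA eB = begin
    Pr (A ∪ B)               ≡⟨ Pr-cong (IsEvent-∪ eA eB∖A) (∪-∖ A B) ⟨
    Pr (A ∪ (B ∩ ∁ A))       ≤⟨ Pr-⊎-≤ eA eB∖A (λ { (ωA , _ , ω∉A) → ω∉A ωA }) Pr-∅ ⟩
    Pr A + Pr (B ∩ ∁ A)      ≤⟨ +-monoʳ-≤ (Pr A) (Pr-mono eB∖A eB proj₁) ⟩
    Pr A + Pr B              ∎
    where
    eB∖A : IsEvent (B ∩ ∁ A)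
    eB∖A = IsEvent-∩ eB (IsEvent-∁ eA)

  Pr≤1 : IsEvent A → Pr A ≤ 1#
  Pr≤1 eA = subst (_ ≤_) Pr-U (Pr-mono eA IsEvent-U _)

  -- Together with the total mass 1 of `B`, a positive mass on `A` would push the union above 1.
  Pr-disjoint-sure : IsEvent A → AlmostSurely S B → A ⊥ B → Pr A ≤ 0#
  Pr-disjoint-sure {A} {B} eA (eB , PrB≡1) A⊥B = +-cancelʳ-≤ 1# (begin
    Pr A + 1#      ≡⟨ cong (Pr A +_) PrB≡1 ⟨
    Pr A + Pr B    ≤⟨ Pr-⊎-≥ eA eB A⊥B ⟩
    Pr (A ∪ B)     ≤⟨ Pr≤1 (IsEvent-∪ eA eB) ⟩
    1#             ≡⟨ +-identityˡ 1# ⟨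
    0# + 1#        ∎)

  sure-satisfiable : AlmostSurely S B → ¬ (∀ ω → ¬ B ω)
  sure-satisfiable (eB , PrB≡1) B-empty = 0≢1
    (trans (sym Pr-∅) (trans (Pr-cong IsEvent-∅ ((λ ()) , λ {ω} → B-empty ω)) PrB≡1))

  -- r < X + Y holds exactly when some rational q satisfies q < X and r - q < Y.
  +-measurable : (X Y : Ω → ℝ) → (∀ r → IsEvent (λ ω → r < X ω)) →
                 (∀ r → IsEvent (λ ω → r < Y ω)) → ∀ r → IsEvent (λ ω → r < X ω + Y ω)
  +-measurable X Y mX mY r = IsEvent-resp-≐
    ((λ { (i , j , k , q<X , r-q<Y) → join q<X r-q<Y }) , split)
    (IsEvent-⋃ _ λ i → IsEvent-⋃ _ λ j → IsEvent-⋃ _ λ k →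
      IsEvent-∩ (mX (rational i j k)) (mY (r - rational i j k)))
    where
    join : ∀ {q s t} → q < s → r - q < t → r < s + t
    join {q} {s} {t} q<s r-q<t = begin-strict
      r            ≡⟨ x-y+y≡x q r ⟨
      r - q + q    <⟨ +-monoˡ-< q r-q<t ⟩
      t + q        ≤⟨ +-monoʳ-≤ t (proj₁ q<s) ⟩
      t + s        ≡⟨ +-comm t s ⟩
      s + t        ∎

    split : ∀ {ω} → r < X ω + Y ω →
            ∃[ i ] ∃[ j ] ∃[ k ] (rational i j k < X ω × r - rational i j k < Y ω)
    split {ω} r<X+Y with rational-dense
      (subst (r - Y ω <_) (x+y-y≡x (Y ω) (X ω)) (+-monoˡ-< (- Y ω) r<X+Y))
    ... | i , j , k , r-Y<q , q<X = i , j , k , q<X ,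
      subst₂ _<_ refl (x+y-y≡x q (Y ω)) (+-monoˡ-< (- q) (begin-strict
        r                <⟨ subst (_< q + Y ω) (x-y+y≡x (Y ω) r) (+-monoˡ-< (Y ω) r-Y<q) ⟩
        q + Y ω          ≡⟨ +-comm q (Y ω) ⟩
        Y ω + q          ∎))
      where
      q : ℝ
      q = rational i j k

  sum-measurable : ∀ {n} (X : Fin n → RandomVariable S) r →
                   IsEvent (λ ω → r < sum (tabulate λ i → value (X i) ω))
  sum-measurable {suc n} X r = +-measurable _ _
    (measurable (X zero)) (sum-measurable (X ∘ suc)) r
  sum-measurable {zero}  X r with lem {r < 0#}
  -- For the empty sum the event does not depend on `ω`: it is everything or nothing.
  ... | yes r<0 = IsEvent-resp-≐ ((λ _ → r<0) , _) IsEvent-U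
  ... | no  r≮0 = IsEvent-resp-≐ ((λ ()) , r≮0) IsEvent-∅

  -- The union bound: if no `X i` exceeds its threshold `t i`, the sum cannot exceed the sum of the
  -- thresholds, hence not `r`.
  Pr-sum-≤ : ∀ {n} (X : Fin n → RandomVariable S) (t : Fin n → ℝ) {r} → sum (tabulate t) ≤ r →
             Pr (λ ω → r < sum (tabulate λ i → value (X i) ω)) ≤ sum (tabulate λ i → Pr[ X i > t i ])
  Pr-sum-≤ {zero}  X t {r} 0≤r = ≤-trans
    (Pr-mono (sum-measurable X r) IsEvent-∅ λ r<0 → <⇒≱ r<0 0≤r) (≤-reflexive Pr-∅)
  Pr-sum-≤ {suc n} X t {r} t≤r = begin
    Pr (λ ω → r < sum (tabulate λ i → value (X i) ω))
      ≤⟨ Pr-mono (sum-measurable X r) (IsEvent-∪ head-event tail-event) cover ⟩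
    Pr ((λ ω → t zero < value (X zero) ω) ∪ tail)
      ≤⟨ Pr-∪-≤ head-event tail-event ⟩
    Pr[ X zero > t zero ] + Pr tail
      ≤⟨ +-monoʳ-≤ _ (Pr-sum-≤ (X ∘ suc) (t ∘ suc) ≤-refl) ⟩
    sum (tabulate λ i → Pr[ X i > t i ])  ∎
    where
    tail : Pred Ω 0ℓ
    tail ω = sum (tabulate (t ∘ suc)) < sum (tabulate λ i → value (X (suc i)) ω)

    head-event : IsEvent (λ ω → t zero < value (X zero) ω)
    head-event = measurable (X zero) (t zero)

    tail-event : IsEvent tail
    tail-event = sum-measurable (X ∘ suc) _

    cover : ∀ {ω} → r < sum (tabulate λ i → value (X i) ω) →
            ((λ ω → t zero < value (X zero) ω) ∪ tail) ω
    cover {ω} r<X with ≤-<-connex (value (X zero) ω) (t zero)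
                     | ≤-<-connex (sum (tabulate λ i → value (X (suc i)) ω)) (sum (tabulate (t ∘ suc)))
    ... | inj₂ t₀<X₀ | _          = inj₁ t₀<X₀
    ... | inj₁ _     | inj₂ t<X   = inj₂ t<X
    ... | inj₁ X₀≤t₀ | inj₁ X≤t   = contradiction (≤-trans (+-mono-≤ X₀≤t₀ X≤t) t≤r) (<⇒≱ r<X)

-- Iterates of `m` tend to zero.

module Iterates (lem : ExcludedMiddle 0ℓ) (R : CompleteOrderedField) where
  open CompleteOrderedField R
  open OrderedField lem R
  open PartialOrderReasoning poset

  fold-bounded : (m : ℝ → ℝ) → (∀ t → 0# ≤ t → 0# ≤ m t × m t ≤ t) →
                 ∀ {z} → 0# ≤ z → ∀ k → 0# ≤ fold z m k × fold z m k ≤ z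
  fold-bounded m m-bound 0≤z zero    = 0≤z , ≤-refl
  fold-bounded m m-bound 0≤z (suc k) =
    let (0≤zₖ , zₖ≤z) = fold-bounded m m-bound 0≤z k
        (0≤m , m≤)    = m-bound _ 0≤zₖ
    in 0≤m , ≤-trans m≤ zₖ≤z

  -- As long as the iterates stay above δ, each application of m decreases
  -- them by at least (1 - m z / z) δ.
  iterates-vanish : (m : ℝ → ℝ) → (∀ t → 0# ≤ t → 0# ≤ m t × m t ≤ t) →
                    ∀ {z} → 0# < z → m z < z →
                    (∀ t → 0# < t → t ≤ z → m t / t ≤ m z / z) →
                    ∀ {δ} → 0# < δ → ∃[ k ] fold z m k < δ
  iterates-vanish m m-bound {z} 0<z mz<z ratio {δ} 0<δ with lem {∃[ k ] fold z m k < δ}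
  ... | yes small = small
  ... | no  large = contradiction (proj₁ (bounds k))
    (<⇒≱ (neg-cancel-< (subst (_< - fold z m k) (sym -0#≈0#) 0<-zₖ)))
    where
    bounds : ∀ k → 0# ≤ fold z m k × fold z m k ≤ z
    bounds = fold-bounded m m-bound (proj₁ 0<z)

    ρ : ℝ
    ρ = m z / z

    0<1-ρ : 0# < 1# - ρ
    0<1-ρ = <⇒0<- (<⇒/<1 0<z mz<z)

    δ≤zₖ : ∀ k → δ ≤ fold z m k
    δ≤zₖ k with ≤-<-connex δ (fold z m k)
    ... | inj₁ δ≤zₖ = δ≤zₖ
    ... | inj₂ zₖ<δ = contradiction (k , zₖ<δ) large

    decrease : ∀ t → δ ≤ t → t ≤ z → m t + (1# - ρ) * δ ≤ t
    decrease t δ≤t t≤z = begin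
      m t + (1# - ρ) * δ
        ≤⟨ +-mono-≤ (/≤⇒≤* 0<t (ratio t 0<t t≤z)) (*-monoʳ-≤ (proj₁ 0<1-ρ) δ≤t) ⟩
      t * ρ + (1# - ρ) * t
        ≡⟨ solve 3 (λ t r s → t :* r :+ s :* t := t :* (s :+ r)) refl t ρ (1# - ρ) ⟩
      t * (1# - ρ + ρ)        ≡⟨ cong (t *_) (x-y+y≡x ρ 1#) ⟩
      t * 1#                  ≡⟨ *-identityʳ t ⟩
      t                       ∎
      where
      0<t : 0# < t
      0<t = ≰⇒> (<⇒≱ 0<δ ∘ ≤-trans δ≤t)

    -- The iterates are negated so that their steady decrease becomes linear growth. Unbounded
    -- growth would then make some iterate negative.
    grows : ∀ k → - fold z m k + (1# - ρ) * δ ≤ - fold z m (suc k)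
    grows k = +-cancelʳ-≤ (fold z m (suc k)) (begin
      - zₖ + c + m zₖ
        ≡⟨ solve 3 (λ n c w → n :+ c :+ w := n :+ (w :+ c)) refl (- zₖ) c (m zₖ) ⟩
      - zₖ + (m zₖ + c)        ≤⟨ +-monoʳ-≤ (- zₖ) (decrease zₖ (δ≤zₖ k) (proj₂ (bounds k))) ⟩
      - zₖ + zₖ                ≡⟨ -‿inverseˡ zₖ ⟩
      0#                       ≡⟨ -‿inverseˡ (m zₖ) ⟨
      - m zₖ + m zₖ            ∎)
      where
      c zₖ : ℝ
      c  = (1# - ρ) * δ
      zₖ = fold z m k

    escape : ∃[ k ] 0# < - fold z m k
    escape = linear-growth-unbounded (λ k → - fold z m k) (*-pos 0<1-ρ 0<δ) grows 0#

    k : ℕ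
    k = proj₁ escape

    0<-zₖ : 0# < - fold z m k
    0<-zₖ = proj₂ escape

-- The tail bound for the probabilistic recurrence.

theorem4 :
  ExcludedMiddle 0ℓ →
  (R : CompleteOrderedField) →
  let open CompleteOrderedField R
      open Probability R
  in
  (n : ℕ) → .{{_ : NonZero n}} →
  (d : ℝ) → 0# ≤ d →
  (h : ℝ → DiscreteDistribution (Vec ℝ n)) →
  (∀ x → 0# ≤ x → ∀ y → Support (h x) y → All (λ t → 0# ≤ t × t ≤ x) y) →
  (S : ℝ → ProbabilitySpace) →
  (W : ∀ x → RandomVariable (S x)) →
  (∀ x → 0# ≤ x → ∀ ω → 0# ≤ value (W x) ω) →
  (a : ℝ → ℝ) →
  (∀ x → 0# ≤ x → x ≤ d → a x ≡ 0#) →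
  (∀ x → d < x → 0# < a x) →
  (∀ x → d < x →
    Σ[ joint ∈ (∀ (y : Vec ℝ n) → Coupling (λ i → W (lookup y i))) ]
    (∀ r → IsSum (λ y → mass (h x) y * PrSum[ joint y > r - a x ])
                 Pr[ W x > r ])) →
  (∀ x → 0# ≤ x → ∃[ k ] TerminatesWithin (Calls h) d k x) →
  (m : ℝ → ℝ) →
  (∀ x → 0# ≤ x → ∃[ e ] (IsExpectation (h x) maximum e × e ≤ m x)) →
  (∀ x → 0# ≤ x → 0# ≤ m x × m x ≤ x) →
  (∀ x y → 0# < x → x ≤ y → m x / x ≤ m y / y) →
  (g₁ g₂ : ℝ → ℝ) →
  (∀ x → 0# ≤ g₁ x) →
  (∀ x → 0# < g₂ x) →
  (∀ x → d < x → 1# ≤ g₁ x) →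
  (∀ x → d < x → ∀ y → Support (h x) y → sum (map g₁ y) ≤ g₁ x × sum (map g₂ y) ≤ g₂ x) →
  (u : ℝ → ℝ) →
  (∀ x → 0# ≤ x → u x ≡ a x / g₂ x + u (m x)) →
  (∀ x → 0# ≤ x → x ≤ d → u x ≡ u d) →
  (∀ x → 0# ≤ x → x ≤ d → AlmostSurely (S x) (λ ω → value (W x) ω / g₂ x ≤ u x)) →
  ContinuousOnNonNeg (λ x → a x / g₂ x) →
  ContinuousOnNonNeg u →
  (∀ x y → 0# ≤ x → 0# ≤ y → 0# < a x / g₂ x → 0# < a y / g₂ y → x < y → a x / g₂ x < a y / g₂ y) →
  (w : ℕ) → .{{_ : NonZero w}} →
  (x : ℝ) → 0# < x → 1# ≤ g₁ x →
  Pr[ W x > g₂ x * u x + w · a x ] ≤ g₁ x * (m x / x) ^ w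
theorem4 lem R n d 0≤d h h-range S W W-nonNeg a a≡0 a>0 recurrence terminates
         m m-mean m-range m-ratio g₁ g₂ g₁-nonNeg g₂-pos g₁≥1 g-subadditive
         u u-rec u-flat W-base _ u-cont A-increasing w x₀ 0<x₀ _ = begin
  Pr[ W x₀ > g₂ x₀ * u x₀ + w · a x₀ ]      ≡⟨ cong Pr[ W x₀ >_] threshold ⟩
  Pr[ W x₀ > g₂ x₀ * (u x₀ + w · A x₀) ]    ≤⟨ final-bound ⟩
  g₁ x₀ * (ρ x₀ ^ w * (x₀ / x₀))
    ≡⟨ cong (g₁ x₀ *_) (trans (cong (ρ x₀ ^ w *_) (x*x⁻¹≡1 0<x₀)) (*-identityʳ _)) ⟩
  g₁ x₀ * ρ x₀ ^ w                        ∎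
  where
  open CompleteOrderedField R
  open Probability R
  open OrderedField lem R
  open Sums lem R
  open Iterates lem R
  open PartialOrderReasoning poset

  -- Properties of the scaled toll `A`, of `m` and of `u`.

  A ρ : ℝ → ℝ
  A x = a x / g₂ x
  ρ x = m x / x

  g₂*A≡a : ∀ x → g₂ x * A x ≡ a x
  g₂*A≡a x = x*[y/x]≡y (a x) (g₂-pos x)

  threshold : g₂ x₀ * u x₀ + w · a x₀ ≡ g₂ x₀ * (u x₀ + w · A x₀)
  threshold = begin-equality
    g₂ x₀ * u x₀ + w · a x₀             ≡⟨ cong (λ t → g₂ x₀ * u x₀ + w · t) (g₂*A≡a x₀) ⟨
    g₂ x₀ * u x₀ + w · (g₂ x₀ * A x₀)    ≡⟨ cong (g₂ x₀ * u x₀ +_) (×-comm-* w (g₂ x₀) (A x₀)) ⟨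
    g₂ x₀ * u x₀ + g₂ x₀ * (w · A x₀)    ≡⟨ distribˡ (g₂ x₀) (u x₀) (w · A x₀) ⟨
    g₂ x₀ * (u x₀ + w · A x₀)           ∎

  d<⇒0< : ∀ {x} → d < x → 0# < x
  d<⇒0< d<x = ≰⇒> λ x≤0 → <⇒≱ d<x (≤-trans x≤0 0≤d)

  A≡0 : ∀ {x} → 0# ≤ x → x ≤ d → A x ≡ 0#
  A≡0 {x} 0≤x x≤d = trans (cong (_/ g₂ x) (a≡0 x 0≤x x≤d)) (zeroˡ _)

  A-pos : ∀ {x} → d < x → 0# < A x
  A-pos {x} d<x = *-pos (a>0 x d<x) (⁻¹-pos (g₂-pos x))

  A-nonNeg : ∀ {x} → 0# ≤ x → 0# ≤ A x
  A-nonNeg {x} 0≤x with ≤-<-connex x d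
  ... | inj₁ x≤d = ≤-reflexive (sym (A≡0 0≤x x≤d))
  ... | inj₂ d<x = proj₁ (A-pos d<x)

  -- Strict increase is assumed where `A` is positive, that is, beyond `d`; up to `d` the smaller
  -- value is zero.
  A-mono : ∀ {x y} → 0# ≤ x → x ≤ y → A x ≤ A y
  A-mono {x} {y} 0≤x x≤y with ≤-<-connex x d
  ... | inj₁ x≤d = subst (_≤ A y) (sym (A≡0 0≤x x≤d)) (A-nonNeg (≤-trans 0≤x x≤y))
  ... | inj₂ d<x with lem {x ≡ y}
  ... | yes refl = ≤-refl
  ... | no  x≢y  = proj₁ (A-increasing x y 0≤x (≤-trans 0≤x x≤y) (A-pos d<x)
    (A-pos (≰⇒> λ y≤d → <⇒≱ d<x (≤-trans x≤y y≤d))) (x≤y , x≢y))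

  ρ-nonNeg : ∀ {x} → 0# < x → 0# ≤ ρ x
  ρ-nonNeg {x} 0<x = /-nonNeg (proj₁ (m-range x (proj₁ 0<x))) 0<x

  m≤ : ∀ {x} → 0# ≤ x → m x ≤ x
  m≤ {x} 0≤x = proj₂ (m-range x 0≤x)

  m-nonNeg : ∀ {x} → 0# ≤ x → 0# ≤ m x
  m-nonNeg {x} 0≤x = proj₁ (m-range x 0≤x)

  -- If `m x` were equal to `x`, the recurrence for `u` would read u(x) = A(x) + u(x), although A(x)
  -- > 0.
  m< : ∀ {x} → d < x → m x < x
  m< {x} d<x = ≰⇒> λ x≤m → <⇒≱ (A-pos d<x) (+-cancelʳ-≤ (u x) (begin
    A x + u x        ≡⟨ cong (λ t → A x + u t) (antisym (m≤ 0≤x) x≤m) ⟨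
    A x + u (m x)    ≡⟨ u-rec x 0≤x ⟨
    u x              ≡⟨ +-identityˡ (u x) ⟨
    0# + u x         ∎))
    where
    0≤x : 0# ≤ x
    0≤x = proj₁ (d<⇒0< d<x)

  u-fold : ∀ {z} → 0# ≤ z → ∀ k → u (fold z m k) ≤ u z
  u-fold     0≤z zero    = ≤-refl
  u-fold {z} 0≤z (suc k) = begin
    u (m zₖ)           ≤⟨ x≤y+x (A-nonNeg 0≤zₖ) ⟩
    A zₖ + u (m zₖ)    ≡⟨ u-rec zₖ 0≤zₖ ⟨
    u zₖ               ≤⟨ u-fold 0≤z k ⟩
    u z                ∎
    where
    zₖ : ℝ
    zₖ = fold z m k
    0≤zₖ : 0# ≤ zₖ
    0≤zₖ = proj₁ (fold-bounded m m-range 0≤z k)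

  -- u does not increase along the iterates of m, which tend to 0, and u is
  -- continuous at 0.
  u-minimal : ∀ {z} → 0# ≤ z → u d ≤ u z
  u-minimal {z} 0≤z with ≤-<-connex z d
  ... | inj₁ z≤d = ≤-reflexive (sym (u-flat z 0≤z z≤d))
  ... | inj₂ d<z with ≤-<-connex (u d) (u z)
  ...   | inj₁ ud≤uz = ud≤uz
  -- The tolerance is the supposed gap between `u 0#`, which equals `u d`, and `u z`. An iterate
  -- close enough to 0 would then have a value of `u` above `u z`.
  ...   | inj₂ uz<ud with u-cont 0# ≤-refl (u 0# - u z)
                          (<⇒0<- (subst (u z <_) (sym (u-flat 0# ≤-refl 0≤d)) uz<ud))
  ...     | δ , 0<δ , near =
    let (k , zₖ<δ) = iterates-vanish m m-range (d<⇒0< d<z) (m< d<z)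
                       (λ t 0<t t≤z → m-ratio t z 0<t t≤z) 0<δ
        0≤zₖ = proj₁ (fold-bounded m m-range 0≤z k)
    in contradiction (u-fold 0≤z k) (<⇒≱ (∣y-x∣<x-z⇒z<y (near _ 0≤zₖ (∣x-0∣<y 0≤zₖ zₖ<δ))))

  -- Almost surely W(d) / g₂(d) ≤ u(d) with a non-negative left side. For negative `u d` this almost
  -- sure event would be empty.
  ud-nonNeg : 0# ≤ u d
  ud-nonNeg with ≤-<-connex 0# (u d)
  ... | inj₁ 0≤ud = 0≤ud
  ... | inj₂ ud<0 = ⊥-elim (Events.sure-satisfiable lem R (S d) (W-base d 0≤d ≤-refl)
    λ ω W≤ud → <⇒≱ ud<0 (≤-trans (/-nonNeg (W-nonNeg d 0≤d ω) (g₂-pos d)) W≤ud))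

  -- On [0, d] the function `u` equals `u d`, so the threshold is at least g₂(x) u(x), which `W x`
  -- exceeds only outside an almost sure event.
  base-bound : ∀ {x r} → 0# ≤ x → x ≤ d → u d ≤ r → Pr[ W x > g₂ x * r ] ≤ 0#
  base-bound {x} {r} 0≤x x≤d ud≤r = Events.Pr-disjoint-sure lem R (S x)
    (measurable (W x) _) (W-base x 0≤x x≤d)
    λ { (g₂r<W , W/g₂≤u) → <⇒≱ g₂r<W (≤-trans (/≤⇒≤* (g₂-pos x) W/g₂≤u)
      (*-monoʳ-≤ (proj₁ (g₂-pos x)) (subst (_≤ r) (sym (u-flat x 0≤x x≤d)) ud≤r))) }

  -- One level of the recurrence.

  children-nonNeg : ∀ {x v} → 0# ≤ x → Support (h x) v → ∀ i → 0# ≤ lookup v i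
  children-nonNeg {x} {v} 0≤x v∈h i = proj₁ (lookup⁺ (h-range x 0≤x v v∈h) i)

  children≤ : ∀ {x v} → 0# ≤ x → Support (h x) v → ∀ i → lookup v i ≤ x
  children≤ {x} {v} 0≤x v∈h i = proj₂ (lookup⁺ (h-range x 0≤x v v∈h) i)

  -- For a fixed tuple of calls, subadditivity of `g₂` fits the thresholds g₂(yᵢ)(r - A(x)) into
  -- g₂(x) r - a(x), and subadditivity of `g₁` collects the resulting tail bounds. Averaging over
  -- the tuples turns the largest call into its expectation, which `m x` bounds.
  recurrence-step : ∀ {x r} C → d < x → 0# ≤ C → 0# ≤ r - A x →
    (∀ v → Support (h x) v → ∀ i → let y = lookup v i in
      Pr[ W y > g₂ y * (r - A x) ] ≤ g₁ y * (C * y)) →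
    Pr[ W x > g₂ x * r ] ≤ g₁ x * (C * m x)
  recurrence-step {x} {r} C d<x 0≤C 0≤r′ children = begin
    Pr[ W x > g₂ x * r ]
      ≤⟨ IsSum-mono (*-nonNeg (g₁-nonNeg x) 0≤C) (decomposition (g₂ x * r)) e-mean weighted ⟩
    g₁ x * C * e            ≤⟨ *-monoʳ-≤ (*-nonNeg (g₁-nonNeg x) 0≤C) e≤m ⟩
    g₁ x * C * m x
      ≡⟨ solve 3 (λ g c m → g :* c :* m := g :* (c :* m)) refl (g₁ x) C (m x) ⟩
    g₁ x * (C * m x)        ∎
    where
    0≤x : 0# ≤ x
    0≤x = proj₁ (d<⇒0< d<x)

    joint : ∀ y → Coupling (λ i → W (lookup y i))
    joint = proj₁ (recurrence x d<x)

    decomposition : ∀ r → IsSum (λ y → mass (h x) y * PrSum[ joint y > r - a x ]) Pr[ W x > r ]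
    decomposition = proj₂ (recurrence x d<x)

    e : ℝ
    e = proj₁ (m-mean x 0≤x)

    e-mean : IsExpectation (h x) maximum e
    e-mean = proj₁ (proj₂ (m-mean x 0≤x))

    e≤m : e ≤ m x
    e≤m = proj₂ (proj₂ (m-mean x 0≤x))

    module _ (v : Vec ℝ n) (v∈h : Support (h x) v) where
      open Coupling (joint v)

      M : ℝ
      M = maximum v

      thresholds : sum (tabulate λ i → g₂ (lookup v i) * (r - A x)) ≤ g₂ x * r - a x
      thresholds = begin
        sum (tabulate λ i → g₂ (lookup v i) * (r - A x))
          ≡⟨ sum-*ʳ (g₂ ∘ lookup v) (r - A x) ⟩
        sum (tabulate (g₂ ∘ lookup v)) * (r - A x)
          ≡⟨ cong (_* (r - A x)) (sum-tabulate-lookup g₂ v) ⟩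
        sum (map g₂ v) * (r - A x)
          ≤⟨ *-monoˡ-≤ 0≤r′ (proj₂ (g-subadditive x d<x v v∈h)) ⟩
        g₂ x * (r - A x)                                      ≤⟨ +≤⇒≤- (≤-reflexive rescale) ⟩
        g₂ x * r - a x                                        ∎
        where
        rescale : g₂ x * (r - A x) + a x ≡ g₂ x * r
        rescale = begin-equality
          g₂ x * (r - A x) + a x             ≡⟨ cong (g₂ x * (r - A x) +_) (g₂*A≡a x) ⟨
          g₂ x * (r - A x) + g₂ x * A x      ≡⟨ distribˡ (g₂ x) (r - A x) (A x) ⟨
          g₂ x * (r - A x + A x)             ≡⟨ cong (g₂ x *_) (x-y+y≡x (A x) r) ⟩
          g₂ x * r                           ∎

      joint-bound : PrSum[ joint v > g₂ x * r - a x ] ≤ g₁ x * (C * M)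
      joint-bound = begin
        PrSum[ joint v > g₂ x * r - a x ]
          ≤⟨ Events.Pr-sum-≤ lem R space copy (λ i → g₂ (lookup v i) * (r - A x)) thresholds ⟩
        sum (tabulate λ i → Pr[ copy i > g₂ (lookup v i) * (r - A x) ])
          -- Each call size is replaced by the largest one, leaving a common factor that can be
          -- taken out of the sum.
          ≤⟨ sum-mono-≤ (λ i → ≤-trans (≤-reflexive (marginal i _)) (≤-trans (children v v∈h i)
               (*-monoʳ-≤ (g₁-nonNeg _) (*-monoʳ-≤ 0≤C (lookup≤maximum v i))))) ⟩
        sum (tabulate λ i → g₁ (lookup v i) * (C * M))
          ≡⟨ sum-*ʳ (g₁ ∘ lookup v) (C * M) ⟩
        sum (tabulate (g₁ ∘ lookup v)) * (C * M)
          ≡⟨ cong (_* (C * M)) (sum-tabulate-lookup g₁ v) ⟩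
        sum (map g₁ v) * (C * M)
          ≤⟨ *-monoˡ-≤ (*-nonNeg 0≤C (maximum-nonNeg v (children-nonNeg 0≤x v∈h)))
               (proj₁ (g-subadditive x d<x v v∈h)) ⟩
        g₁ x * (C * M)
          ∎

    weighted : ∀ v → mass (h x) v * PrSum[ joint v > g₂ x * r - a x ] ≤
               g₁ x * C * (mass (h x) v * maximum v)
    weighted v with lem {Support (h x) v}
    ... | yes v∈h = begin
      mass (h x) v * PrSum[ joint v > g₂ x * r - a x ]
        ≤⟨ *-monoʳ-≤ (proj₁ v∈h) (joint-bound v v∈h) ⟩
      mass (h x) v * (g₁ x * (C * maximum v))
        ≡⟨ solve 4 (λ p g c m → p :* (g :* (c :* m)) := g :* c :* (p :* m))
           refl (mass (h x) v) (g₁ x) C (maximum v) ⟩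
      g₁ x * C * (mass (h x) v * maximum v)               ∎
    ... | no  v∉h = begin
      mass (h x) v * PrSum[ joint v > g₂ x * r - a x ]
        ≡⟨ cong (_* PrSum[ joint v > g₂ x * r - a x ]) massless ⟩
      0# * PrSum[ joint v > g₂ x * r - a x ]              ≡⟨ zeroˡ _ ⟩
      0#                                                  ≡⟨ zeroʳ (g₁ x * C) ⟨
      g₁ x * C * 0#
        ≡⟨ cong (g₁ x * C *_) (zeroˡ (maximum v)) ⟨
      g₁ x * C * (0# * maximum v)
        ≡⟨ cong (λ p → g₁ x * C * (p * maximum v)) massless ⟨
      g₁ x * C * (mass (h x) v * maximum v)               ∎
      where
      massless : mass (h x) v ≡ 0#
      massless with ≤-<-connex (mass (h x) v) 0#
      ... | inj₁ p≤0 = antisym p≤0 (mass-nonNeg (h x) v)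
      ... | inj₂ 0<p = contradiction 0<p v∉h

  -- A single term of the expectation is a partial sum, so the mass of `v` times its maximum is at
  -- most m(x) ≤ 0, and that mass is positive.
  children-vanish : ∀ {x} → 0# ≤ x → m x ≤ 0# → ∀ v → Support (h x) v → ∀ i → lookup v i ≤ 0#
  children-vanish {x} 0≤x mx≤0 v v∈h i = ≤-trans (lookup≤maximum v i) (*-cancelˡ-≤ v∈h (begin
    mass (h x) v * maximum v
      ≤⟨ proj₁ (proj₁ (proj₂ (m-mean x 0≤x))) _ (v ∷ [] , [] ∷ [] , sym (+-identityʳ _)) ⟩
    proj₁ (m-mean x 0≤x)             ≤⟨ proj₂ (proj₂ (m-mean x 0≤x)) ⟩
    m x                              ≤⟨ mx≤0 ⟩
    0#                               ≡⟨ zeroʳ (mass (h x) v) ⟨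
    mass (h x) v * 0#                ∎))

  -- The monotonicity of m(x) / x with denominators cleared, so that it can be used for positive
  -- `m z` and for `m z` zero alike.
  m*z≤x*m : ∀ {x z} → 0# < x → x ≤ z → m x * z ≤ x * m z
  m*z≤x*m {x} {z} 0<x x≤z = begin
    m x * z            ≤⟨ *-monoˡ-≤ (≤-trans (proj₁ 0<x) x≤z) (/≤⇒≤* 0<x (m-ratio x z 0<x x≤z)) ⟩
    x * ρ z * z        ≡⟨ solve 3 (λ x r z → x :* r :* z := x :* (z :* r)) refl x (ρ z) z ⟩
    x * (z * ρ z)      ≡⟨ cong (x *_) (x*[y/x]≡y (m z) (≰⇒> λ z≤0 → <⇒≱ 0<x (≤-trans x≤z z≤0))) ⟩
    x * m z            ∎

  -- The induction on the depth of the recursion.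

  TailBound : ℝ → Set
  TailBound x = ∀ j z r → 0# < z → u z + j · A x ≤ r →
                Pr[ W x > g₂ x * r ] ≤ g₁ x * (ρ x ^ j * (x / z))

  -- Since r ≥ u(z) ≥ u(d), the probability is zero, and it remains to see that the right side is
  -- non-negative.
  base-tail : ∀ {x} → 0# ≤ x → x ≤ d → TailBound x
  base-tail {x} 0≤x x≤d j z r 0<z uz+jA≤r = ≤-trans
    (base-bound 0≤x x≤d (≤-trans (u-minimal (proj₁ 0<z))
      (≤-trans (x≤x+y (·-nonNeg j (A-nonNeg 0≤x))) uz+jA≤r)))
    (*-nonNeg (g₁-nonNeg x) 0≤ρʲx/z)
    where
    0≤ρʲx/z : 0# ≤ ρ x ^ j * (x / z)
    -- At size 0 the ratio `ρ` divides by zero and has no known sign; there the factor `x / z`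
    -- vanishes.
    0≤ρʲx/z with ≤-<-connex x 0#
    ... | inj₁ x≤0 = ≤-reflexive (sym (trans (cong (λ t → ρ x ^ j * (t / z)) (antisym x≤0 0≤x))
                       (trans (cong (ρ x ^ j *_) (zeroˡ _)) (zeroʳ _))))
    ... | inj₂ 0<x = *-nonNeg (^-nonNeg j (ρ-nonNeg 0<x)) (/-nonNeg 0≤x 0<z)

  tail-step : ∀ {x} → d < x → (∀ v → Support (h x) v → ∀ i → TailBound (lookup v i)) → TailBound x
  tail-step {x} d<x IH (suc j) z r 0<z uz+jA≤r = begin
    Pr[ W x > g₂ x * r ]
      ≤⟨ recurrence-step C d<x 0≤C
           (≤-trans 0≤uz (≤-trans (x≤x+y (·-nonNeg j (A-nonNeg 0≤x))) uz+jA≤r′)) children ⟩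
    g₁ x * (C * m x)                    ≡⟨ cong (λ t → g₁ x * (C * t)) (x*[y/x]≡y (m x) 0<x) ⟨
    g₁ x * (C * (x * ρ x))
      ≡⟨ solve 5 (λ g p i x r → g :* (p :* i :* (x :* r)) := g :* (r :* p :* (x :* i)))
         refl (g₁ x) (ρ x ^ j) (z ⁻¹) x (ρ x) ⟩
    g₁ x * (ρ x ^ suc j * (x / z))      ∎
    where
    0<x : 0# < x
    0<x = d<⇒0< d<x

    0≤x : 0# ≤ x
    0≤x = proj₁ 0<x

    0≤uz : 0# ≤ u z
    0≤uz = ≤-trans ud-nonNeg (u-minimal (proj₁ 0<z))

    C : ℝ
    C = ρ x ^ j / z

    0≤C : 0# ≤ C
    0≤C = /-nonNeg (^-nonNeg j (ρ-nonNeg 0<x)) 0<z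

    -- One of the `suc j` copies of `A x` pays for the toll at `x`; the other `j` are left for the
    -- calls.
    uz+jA≤r′ : u z + j · A x ≤ r - A x
    uz+jA≤r′ = +≤⇒≤- (subst (_≤ r)
      (solve 3 (λ u b a → u :+ (a :+ b) := u :+ b :+ a) refl (u z) (j · A x) (A x)) uz+jA≤r)

    scale : ∀ {y} → 0# ≤ y → y ≤ x → ρ y ^ j * (y / z) ≤ C * y
    scale {y} 0≤y y≤x with ≤-<-connex y 0#
    ... | inj₁ y≤0 rewrite antisym y≤0 0≤y = ≤-reflexive
      (trans (trans (cong (ρ 0# ^ j *_) (zeroˡ _)) (zeroʳ _)) (sym (zeroʳ C)))
    ... | inj₂ 0<y = begin
      ρ y ^ j * (y / z)
        ≤⟨ *-monoˡ-≤ (/-nonNeg 0≤y 0<z) (^-mono-≤ j (ρ-nonNeg 0<y) (m-ratio y x 0<y y≤x)) ⟩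
      ρ x ^ j * (y / z)
        ≡⟨ solve 3 (λ p y i → p :* (y :* i) := p :* i :* y) refl (ρ x ^ j) y (z ⁻¹) ⟩
      C * y                ∎

    children : ∀ v → Support (h x) v → ∀ i → let y = lookup v i in
               Pr[ W y > g₂ y * (r - A x) ] ≤ g₁ y * (C * y)
    children v v∈h i = ≤-trans
      -- The copies of `A x` cover as many copies of `A y`, because `A` is non-decreasing and y ≤ x.
      (IH v v∈h i j z (r - A x) 0<z (≤-trans (+-monoʳ-≤ (u z) (·-mono-≤ j (A-mono 0≤y y≤x))) uz+jA≤r′))
      (*-monoʳ-≤ (g₁-nonNeg _) (scale 0≤y y≤x))
      where
      0≤y = children-nonNeg 0≤x v∈h i
      y≤x = children≤ 0≤x v∈h i
  tail-step {x} d<x IH zero z r 0<z uz+0≤r with ≤-<-connex z x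
  ... | inj₁ z≤x = begin
    Pr[ W x > g₂ x * r ]     ≤⟨ Events.Pr≤1 lem R (S x) (measurable (W x) _) ⟩
    1#                       ≤⟨ g₁≥1 x d<x ⟩
    g₁ x                     ≡⟨ *-identityʳ (g₁ x) ⟨
    g₁ x * 1#
      ≤⟨ *-monoʳ-≤ (g₁-nonNeg x) (*≤⇒≤/ 0<z (subst (_≤ x) (sym (*-identityʳ z)) z≤x)) ⟩
    g₁ x * (x / z)           ≡⟨ cong (g₁ x *_) (*-identityˡ (x / z)) ⟨
    g₁ x * (1# * (x / z))    ∎
  ... | inj₂ x<z = main (≤-<-connex (m z) 0#)
    where
    0<x : 0# < x
    0<x = d<⇒0< d<x

    0≤x : 0# ≤ x
    0≤x = proj₁ 0<x

    -- Passing from `z` to `m z` lowers `u` by `A z`, which is at least the scaled toll `A x`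
    -- because x < z.
    umz≤r′ : u (m z) ≤ r - A x
    umz≤r′ = +≤⇒≤- (begin
      u (m z) + A x    ≤⟨ +-monoʳ-≤ (u (m z)) (A-mono 0≤x (proj₁ x<z)) ⟩
      u (m z) + A z    ≡⟨ +-comm (u (m z)) (A z) ⟩
      A z + u (m z)    ≡⟨ u-rec z (proj₁ 0<z) ⟨
      u z              ≡⟨ +-identityʳ (u z) ⟨
      u z + 0#         ≤⟨ uz+0≤r ⟩
      r                ∎)

    ud≤r′ : u d ≤ r - A x
    ud≤r′ = ≤-trans (u-minimal (m-nonNeg (proj₁ 0<z))) umz≤r′

    0≤r′ : 0# ≤ r - A x
    0≤r′ = ≤-trans ud-nonNeg ud≤r′

    main : m z ≤ 0# ⊎ 0# < m z → Pr[ W x > g₂ x * r ] ≤ g₁ x * (1# * (x / z))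
    main (inj₂ 0<mz) = begin
      Pr[ W x > g₂ x * r ]
        ≤⟨ recurrence-step (m z ⁻¹) d<x (proj₁ (⁻¹-pos 0<mz)) 0≤r′ children ⟩
      g₁ x * (m z ⁻¹ * m x)      ≤⟨ *-monoʳ-≤ (g₁-nonNeg x) (*≤⇒≤/ 0<z scaled) ⟩
      g₁ x * (x / z)             ≡⟨ cong (g₁ x *_) (*-identityˡ (x / z)) ⟨
      g₁ x * (1# * (x / z))      ∎
      where
      scaled : z * (m z ⁻¹ * m x) ≤ x
      scaled = begin
        z * (m z ⁻¹ * m x)
          ≡⟨ solve 3 (λ z i m → z :* (i :* m) := i :* (m :* z)) refl z (m z ⁻¹) (m x) ⟩
        m z ⁻¹ * (m x * z)      ≤⟨ *-monoʳ-≤ (proj₁ (⁻¹-pos 0<mz)) (m*z≤x*m 0<x (proj₁ x<z)) ⟩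
        m z ⁻¹ * (x * m z)
          ≡⟨ solve 3 (λ i x m → i :* (x :* m) := m :* (x :* i)) refl (m z ⁻¹) x (m z) ⟩
        m z * (x / m z)         ≡⟨ x*[y/x]≡y x 0<mz ⟩
        x                       ∎

      children : ∀ v → Support (h x) v → ∀ i → let y = lookup v i in
                 Pr[ W y > g₂ y * (r - A x) ] ≤ g₁ y * (m z ⁻¹ * y)
      children v v∈h i = ≤-trans
        (IH v v∈h i 0 (m z) (r - A x) 0<mz (subst (_≤ r - A x) (sym (+-identityʳ (u (m z)))) umz≤r′))
        (≤-reflexive (cong (g₁ _ *_) (trans (*-identityˡ _) (*-comm _ _))))
    main (inj₁ mz≤0) = begin
      Pr[ W x > g₂ x * r ]       ≤⟨ recurrence-step 0# d<x ≤-refl 0≤r′ children ⟩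
      g₁ x * (0# * m x)          ≡⟨ cong (g₁ x *_) (zeroˡ (m x)) ⟩
      g₁ x * 0#                  ≤⟨ *-monoʳ-≤ (g₁-nonNeg x) (*-nonNeg 0≤1 (/-nonNeg 0≤x 0<z)) ⟩
      g₁ x * (1# * (x / z))      ∎
      where
      mx≤0 : m x ≤ 0#
      mx≤0 = *-cancelˡ-≤ 0<z (begin
        z * m x    ≡⟨ *-comm z (m x) ⟩
        m x * z    ≤⟨ m*z≤x*m 0<x (proj₁ x<z) ⟩
        x * m z    ≤⟨ *-monoʳ-≤ 0≤x mz≤0 ⟩
        x * 0#     ≡⟨ trans (zeroʳ x) (sym (zeroʳ z)) ⟩
        z * 0#     ∎)

      children : ∀ v → Support (h x) v → ∀ i → let y = lookup v i in
                 Pr[ W y > g₂ y * (r - A x) ] ≤ g₁ y * (0# * y)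
      children v v∈h i = ≤-trans
        (base-bound (children-nonNeg 0≤x v∈h i) (≤-trans (children-vanish 0≤x mx≤0 v v∈h i) 0≤d) ud≤r′)
        (≤-reflexive (sym (trans (cong (g₁ _ *_) (zeroˡ _)) (zeroʳ _))))

  -- A chain of `k` calls from `y` becomes a chain of `suc k` calls from `x` when `x` is put in
  -- front.
  terminates-child : ∀ {k x y} → Calls h x y → TerminatesWithin (Calls h) d (suc k) x →
                     TerminatesWithin (Calls h) d k y
  terminates-child {k} {x} x⟶y within s refl steps =
    within (λ { zero → x ; (suc j) → s j }) refl
      λ { zero _ → x⟶y ; (suc j) (s≤s j<k) → steps j j<k }

  tail-bound : ∀ k x → 0# ≤ x → TerminatesWithin (Calls h) d k x → TailBound x
  -- With no calls left, the constant sequence at `x` is a legitimate chain, so x ≤ d.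
  tail-bound zero    x 0≤x within = base-tail 0≤x (within (const x) refl λ _ ())
  tail-bound (suc k) x 0≤x within with ≤-<-connex x d
  ... | inj₁ x≤d = base-tail 0≤x x≤d
  ... | inj₂ d<x = tail-step d<x λ v v∈h i →
    tail-bound k (lookup v i) (children-nonNeg 0≤x v∈h i)
      (terminates-child (v , v∈h , ∈-lookup i v) within)

  final-bound : Pr[ W x₀ > g₂ x₀ * (u x₀ + w · A x₀) ] ≤ g₁ x₀ * (ρ x₀ ^ w * (x₀ / x₀))
  final-bound = let (k , within) = terminates x₀ (proj₁ 0<x₀) in
    tail-bound k x₀ (proj₁ 0<x₀) within w x₀ _ 0<x₀ ≤-refl
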